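{- Let $\alpha_1,\ldots,\alpha_r$ be positive integers. Then there exist distinct primes $p_1<\cdots<p_r$ such that $p_1^{\alpha_1}\cdots p_r^{\alpha_r}$ is a covering number if and only if one of the following holds: (i) $r=2$ and $\alpha_1\geqslant 2$; (ii) $r=3$ and $\max\{\alpha_1,\alpha_2\}\geqslant 2$; (iii) $r\geqslant 4$.
   Context: For $a\in\mathbb{Z}$ and a positive integer $n$, $a(\mathrm{mod}\ n)=\{a+nx: x\in\mathbb{Z}\}$ is the residue class with modulus $n$. A finite system of residue classes $\{a_i(\mathrm{mod}\ n_i)\}_{i=1}^k$ is a cover of $\mathbb{Z}$ if every integer lies in at least one of the classes $a_i(\mathrm{mod}\ n_i)$. A positive integer $n$ is called a covering number if there is a cover of $\mathbb{Z}$ whose moduli are all distinct, greater than one, and divisors of $n$. -}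

module Defs where

import Data.Fin.Base as Fin
open import Data.Integer.Base using (ℤ; +_)
import Data.Integer.Base as ℤ
open import Data.Nat.Base using (ℕ; _*_; _<_)
open import Data.Nat.Divisibility using (_∣_)
open import Data.Product.Base using (∃-syntax)
open import Data.Vec.Functional using (Vector; foldr)
open import Function.Definitions using (Injective)
open import Level using (0ℓ)
open import Relation.Binary.PropositionalEquality using (_≡_)
open import Relation.Unary using (Pred; _∈_)

-- The set { a + n x : x ∈ ℤ }.  Meaningful as a residue class for n > 0; the
-- only use below is with moduli n > 1.
_mod_ : ℤ → ℕ → Pred ℤ 0ℓ
(a mod n) z = ∃[ x ] z ≡ a ℤ.+ (+ n) ℤ.* x

IsCover : ∀ {k} → Vector ℤ k → Vector ℕ k → Set
IsCover a n = ∀ (z : ℤ) → ∃[ i ] z ∈ (a i mod n i)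

record CoveringNumber (N : ℕ) : Set where
  field
    positive : 0 < N
    size     : ℕ
    residue  : Vector ℤ size
    modulus  : Vector ℕ size
    cover    : IsCover residue modulus
    distinct : Injective _≡_ _≡_ modulus
    >1       : ∀ i → 1 < modulus i
    divides  : ∀ i → modulus i ∣ N

∏ : ∀ {r} → Vector ℕ r → ℕ
∏ = foldr _*_ 1

StrictlyIncreasing : ∀ {r} → Vector ℕ r → Set
StrictlyIncreasing p = ∀ {i j} → i Fin.< j → p i < p j

{-# OPTIONS --safe #-}

-- Necessity.  Let r be a prime exceeding the number of divisors of N.  If the
-- classes whose moduli divide N r^(c+1) cover ℤ, then so do those whose moduli
-- divide M = N r^c.  Otherwise some z, and with it every lift z + t M with
-- 0 ≤ t < r, lies outside the latter classes, so each lift lies in a class with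
-- modulus d r^(c+1), d ∣ N.  There are fewer than r such moduli, so two lifts
-- share a class with some modulus n ∤ M; but n divides r M and (t′ - t) M,
-- hence M.  Removing from p^a, p q^b and p q s^c (p < q < s) one prime factor
-- at a time, starting with the largest, therefore leaves a cover by classes
-- with moduli dividing 1, which is absurd.
--
-- Sufficiency.  Multiples of covering numbers are covering numbers, and
-- 12 = 2²·3, 90 = 2·3²·5 and 210 = 2·3·5·7 are covering numbers.

module Submission where

open import Data.Fin.Base using (zero; suc; cast; Fin; toℕ; fromℕ<)
import Data.Fin.Base as Fin
open import Data.Fin.Properties using (all?; any?; pigeonhole; toℕ<n; toℕ-fromℕ<)
  renaming (_≟_ to _≟ᶠ_)
open import Data.Integer.Base using (ℤ; +_)
import Data.Integer.Base as ℤ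
open import Data.Integer.Divisibility.Signed as Signed using (∣⇒∣ᵤ)
open import Data.Integer.DivMod using (_%ℕ_; _/ℕ_; n%ℕd<d; a≡a%ℕn+[a/ℕn]*n)
import Data.Integer.Properties as ℤₚ
import Data.Integer.Tactic.RingSolver as ℤSolver
open import Data.List.Base as List using (List; []; _∷_; [_]; _++_; map; length)
import Data.List.Membership.Propositional as List
open import Data.List.Membership.Propositional.Properties using (∈-++⁺ˡ; ∈-++⁺ʳ; ∈-map⁺)
open import Data.List.Relation.Unary.All using (_∷_)
open import Data.List.Relation.Unary.Any using (here; index)
open import Data.List.Relation.Unary.Any.Properties using (lookup-index)
open import Data.Nat.Base using (ℕ; zero; suc; _+_; _*_; _∸_; _≤_; _≥_; _<_; _^_; _⊔_; _!; NonZero;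
  z≤n; s≤s; s≤s⁻¹; s<s⁻¹; >-nonZero; >-nonZero⁻¹; nonTrivial⇒n>1)
open import Data.Nat.Coprimality using (coprime-factors; prime⇒coprime)
open import Data.Nat.Divisibility
open import Data.Nat.Primality using (Prime; prime?; euclidsLemma; composite[4];
  composite⇒¬prime; prime⇒nonZero; prime⇒nonTrivial)
open import Data.Nat.Primality.Factorisation using (factorise)
open import Data.Nat.Properties
open import Data.Nat.Tactic.RingSolver using (solve-∀)
open import Data.Product.Base using (Σ-syntax; ∃-syntax; _×_; _,_; proj₁; proj₂)
open import Data.Sum.Base using (_⊎_; inj₁; inj₂)
open import Data.Vec.Base using (Vec; []; _∷_; lookup)
open import Data.Vec.Functional using (Vector) renaming ([] to []ᵛ; _∷_ to _∷ᵛ_)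
open import Function.Base using (_∘_)
open import Function.Bundles using (_⇔_; mk⇔)
open import Function.Definitions using (Injective)
open import Relation.Binary.PropositionalEquality
  using (_≡_; refl; sym; trans; cong; cong₂; subst; module ≡-Reasoning)
open import Relation.Nullary using (¬_; Dec; yes; no; contradiction)
open import Relation.Nullary.Decidable using (True; toWitness; _→-dec_; _×-dec_)
open import Relation.Unary using (_∈_)
open import Defs

-- Divisors of a number times a prime power.

-- Only containment is asked, so `ds` may have repetitions or other entries; its length still bounds
-- the number of divisors of `N`.
DivisorsAmong : ℕ → List ℕ → Set
DivisorsAmong N ds = ∀ {d} → d ∣ N → d List.∈ ds

divisorsAmong-1 : DivisorsAmong 1 [ 1 ]
divisorsAmong-1 d∣1 = here (∣1⇒≡1 d∣1)

^-monoʳ-∣ : ∀ m {j k} → j ≤ k → m ^ j ∣ m ^ k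
^-monoʳ-∣ m {j} {k} j≤k = divides (m ^ (k ∸ j)) (begin
  m ^ k                 ≡⟨ cong (m ^_) (m∸n+n≡m j≤k) ⟨
  m ^ (k ∸ j + j)       ≡⟨ ^-distribˡ-+-* m (k ∸ j) j ⟩
  m ^ (k ∸ j) * m ^ j   ∎)
  where open ≡-Reasoning

-- Euclid's lemma puts one factor `p` into `n`; cancelling it on both sides leaves the same claim
-- with exponent `k` lowered by one.
primePower∣*⇒∣ : ∀ {p m} → Prime p → ¬ p ∣ m → ∀ k {n} → p ^ k ∣ m * n → p ^ k ∣ n
primePower∣*⇒∣ pp p∤m zero _ = 1∣ _
primePower∣*⇒∣ {p} {m} pp p∤m (suc k) {n} pᵏ⁺¹∣mn
  with euclidsLemma m n pp (m*n∣⇒m∣ p (p ^ k) pᵏ⁺¹∣mn)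
... | inj₁ p∣m = contradiction p∣m p∤m
... | inj₂ (divides q refl) =
  subst (p * p ^ k ∣_) (*-comm p q) (*-monoʳ-∣ p (primePower∣*⇒∣ pp p∤m k pᵏ∣mq))
  where
  instance _ = prime⇒nonZero pp
  pᵏ∣mq : p ^ k ∣ m * q
  pᵏ∣mq = *-cancelˡ-∣ p (subst (p * p ^ k ∣_) (lemma m q p) pᵏ⁺¹∣mn)
    where
    lemma : ∀ m q p → m * (q * p) ≡ p * (m * q)
    lemma = solve-∀

-- Let N p^(c+1) = q n. If `p` divided `q`, cancelling it would give n ∣ N p^c. So `p` does not
-- divide `q`, the whole power p^(c+1) lies in `n`, and N = q d for the cofactor `d`.
newDivisor : ∀ {p N n} → Prime p → ∀ c → n ∣ N * p ^ suc c → ¬ n ∣ N * p ^ c →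
             ∃[ d ] d ∣ N × n ≡ d * p ^ suc c
newDivisor {p} {N} {n} pp c (divides q Npᶜ⁺¹≡qn) n∤Npᶜ
  with primePower∣*⇒∣ pp p∤q (suc c) (divides N (sym Npᶜ⁺¹≡qn))
  where
  instance _ = prime⇒nonZero pp
  p∤q : ¬ p ∣ q
  p∤q (divides s refl) = n∤Npᶜ (divides s (*-cancelˡ-≡ _ _ p (begin
    p * (N * p ^ c)  ≡⟨ lemma₁ p N (p ^ c) ⟩
    N * (p * p ^ c)  ≡⟨ Npᶜ⁺¹≡qn ⟩
    s * p * n        ≡⟨ lemma₂ s p n ⟩
    p * (s * n)      ∎)))
    where
    open ≡-Reasoning
    lemma₁ : ∀ p N m → p * (N * m) ≡ N * (p * m)
    lemma₁ = solve-∀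
    lemma₂ : ∀ s p n → s * p * n ≡ p * (s * n)
    lemma₂ = solve-∀
... | divides d refl = d , divides q (*-cancelʳ-≡ _ _ (p ^ suc c) (begin
    N * p ^ suc c        ≡⟨ Npᶜ⁺¹≡qn ⟩
    q * (d * p ^ suc c)  ≡⟨ *-assoc q d _ ⟨
    q * d * p ^ suc c    ∎)) , refl
  where
  open ≡-Reasoning
  instance
    _ = prime⇒nonZero pp
    _ = m^n≢0 p (suc c)

-- A divisor of N p that does not divide `N` is `p` times a divisor of `N`, by `newDivisor` with
-- exponent c = 0.
divisorsAmong-* : ∀ {p N ds} → Prime p → DivisorsAmong N ds →
                  DivisorsAmong (N * p) (ds ++ map (_* p) ds)
divisorsAmong-* {p} {N} {ds} pp among {d} d∣Np with d ∣? N
... | yes d∣N = ∈-++⁺ˡ (among d∣N)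
... | no  d∤N
  with e , e∣N , refl ← newDivisor {N = N} pp 0 (subst (λ m → d ∣ N * m) (sym (*-identityʳ p)) d∣Np)
                                        (d∤N ∘ subst (d ∣_) (*-identityʳ N))
  = ∈-++⁺ʳ ds (subst (λ m → e * m List.∈ map (_* p) ds) (sym (*-identityʳ p))
                     (∈-map⁺ (_* p) (among e∣N)))

-- Removing a large prime from a cover.

module _ {k} (a : Vector ℤ k) (n : Vector ℕ k) where

  -- The family of classes stays fixed while `M` shrinks, so distinctness of the moduli is inherited
  -- at every stage.
  CoversByDivisors : ℕ → Set
  CoversByDivisors M = ∀ z → ∃[ i ] n i ∣ M × z ∈ (a i mod n i)

  -- The lift z + t M differs from `z` by a multiple of M, hence of the modulus.
  ∈mod-cancel : ∀ {M i} z t → n i ∣ M → (z ℤ.+ + t ℤ.* + M) ∈ (a i mod n i) → z ∈ (a i mod n i)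
  ∈mod-cancel {_} {i} z t (divides q refl) (x , eq) = x ℤ.- + t ℤ.* + q , (begin
    z
      ≡⟨ lemma₁ z (+ t ℤ.* + (q * n i)) ⟩
    (z ℤ.+ + t ℤ.* + (q * n i)) ℤ.- + t ℤ.* + (q * n i)
      ≡⟨ cong₂ (λ u v → u ℤ.- + t ℤ.* v) eq (ℤₚ.pos-* q (n i)) ⟩
    (a i ℤ.+ + n i ℤ.* x) ℤ.- + t ℤ.* (+ q ℤ.* + n i)
      ≡⟨ lemma₂ (a i) (+ n i) x (+ t) (+ q) ⟩
    a i ℤ.+ + n i ℤ.* (x ℤ.- + t ℤ.* + q) ∎)
    where
    open ≡-Reasoning
    lemma₁ : ∀ z w → z ≡ (z ℤ.+ w) ℤ.- w
    lemma₁ = ℤSolver.solve-∀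
    lemma₂ : ∀ a n x t q → (a ℤ.+ n ℤ.* x) ℤ.- t ℤ.* (q ℤ.* n) ≡ a ℤ.+ n ℤ.* (x ℤ.- t ℤ.* q)
    lemma₂ = ℤSolver.solve-∀

  lifts∈mod⇒∣ : ∀ {M i z t t′} → t ≤ t′ → (z ℤ.+ + t ℤ.* + M) ∈ (a i mod n i) →
                (z ℤ.+ + t′ ℤ.* + M) ∈ (a i mod n i) → n i ∣ (t′ ∸ t) * M
  lifts∈mod⇒∣ {M} {i} {z} {t} {t′} t≤t′ (x , eq) (x′ , eq′) =
    ∣⇒∣ᵤ (Signed.divides (x′ ℤ.- x) (begin
      + ((t′ ∸ t) * M)
        ≡⟨ ℤₚ.pos-* (t′ ∸ t) M ⟩
      + (t′ ∸ t) ℤ.* + M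
        ≡⟨ lemma₁ z (+ t) (+ (t′ ∸ t)) (+ M) ⟩
      (z ℤ.+ (+ t ℤ.+ + (t′ ∸ t)) ℤ.* + M) ℤ.- (z ℤ.+ + t ℤ.* + M)
        ≡⟨ cong (λ u → (z ℤ.+ + u ℤ.* + M) ℤ.- (z ℤ.+ + t ℤ.* + M)) (m+[n∸m]≡n t≤t′) ⟩
      (z ℤ.+ + t′ ℤ.* + M) ℤ.- (z ℤ.+ + t ℤ.* + M)
        ≡⟨ cong₂ ℤ._-_ eq′ eq ⟩
      (a i ℤ.+ + n i ℤ.* x′) ℤ.- (a i ℤ.+ + n i ℤ.* x)
        ≡⟨ lemma₂ (a i) (+ n i) x x′ ⟩
      (x′ ℤ.- x) ℤ.* + n i ∎))
    where
    open ≡-Reasoning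
    lemma₁ : ∀ z t u M → u ℤ.* M ≡ (z ℤ.+ (t ℤ.+ u) ℤ.* M) ℤ.- (z ℤ.+ t ℤ.* M)
    lemma₁ = ℤSolver.solve-∀
    lemma₂ : ∀ a n x x′ → (a ℤ.+ n ℤ.* x′) ℤ.- (a ℤ.+ n ℤ.* x) ≡ (x′ ℤ.- x) ℤ.* n
    lemma₂ = ℤSolver.solve-∀

  module _ (distinct : Injective _≡_ _≡_ n) {r N ds} (pr : Prime r)
           (among : DivisorsAmong N ds) (few : length ds < r) where

    module _ c (covers : CoversByDivisors (N * r ^ suc c)) (z : ℤ) where

      private
        M = N * r ^ c

        class : Fin r → Fin k
        class t = proj₁ (covers (z ℤ.+ + toℕ t ℤ.* + M))

        class∣ : ∀ t → n (class t) ∣ N * r ^ suc c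
        class∣ t = proj₁ (proj₂ (covers (z ℤ.+ + toℕ t ℤ.* + M)))

        ∈class : ∀ t → (z ℤ.+ + toℕ t ℤ.* + M) ∈ (a (class t) mod n (class t))
        ∈class t = proj₂ (proj₂ (covers (z ℤ.+ + toℕ t ℤ.* + M)))

      -- The negated form supplies the hypothesis of `newDivisor` for all lifts at once;
      -- `lowerExponent` then finds an actual lift by a decidable search over `Fin r`.
      someLift∣ : ¬ (∀ t → ¬ n (class t) ∣ M)
      someLift∣ ∤M = collide (pigeonhole few code)
        where
        open ≡-Reasoning

        new : ∀ t → ∃[ d ] d ∣ N × n (class t) ≡ d * r ^ suc c
        new t = newDivisor pr c (class∣ t) (∤M t)

        -- The position of the cofactor `d` in `ds` determines the modulus d r^(c+1), and by
        -- distinctness the class.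
        code : Fin r → Fin (length ds)
        code t = index (among (proj₁ (proj₂ (new t))))

        decode : ∀ t → n (class t) ≡ List.lookup ds (code t) * r ^ suc c
        decode t = trans (proj₂ (proj₂ (new t)))
          (cong (_* r ^ suc c) (lookup-index (among (proj₁ (proj₂ (new t))))))

        collide : ¬ (∃[ t ] ∃[ t′ ] t Fin.< t′ × code t ≡ code t′)
        -- The modulus divides both r M and (t′ - t) M. Since 0 < t′ - t < r, the prime `r` is
        -- coprime to t′ - t, so the modulus divides M.
        collide (t , t′ , t<t′ , code≡) = ∤M t (coprime-factors (prime⇒coprime pr u<r)
          ( subst (n (class t) ∣_) (lemma N r (r ^ c)) (class∣ t)
          , lifts∈mod⇒∣ {z = z} (<⇒≤ t<t′) (∈class t)
              (subst (λ i → (z ℤ.+ + toℕ t′ ℤ.* + M) ∈ (a i mod n i)) (sym class≡) (∈class t′))))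
          where
          class≡ : class t ≡ class t′
          class≡ = distinct (begin
            n (class t)                              ≡⟨ decode t ⟩
            List.lookup ds (code t) * r ^ suc c      ≡⟨ cong (λ i → List.lookup ds i * r ^ suc c) code≡ ⟩
            List.lookup ds (code t′) * r ^ suc c     ≡⟨ decode t′ ⟨
            n (class t′)                             ∎)
          instance _ = >-nonZero (m<n⇒0<n∸m t<t′)
          u<r : toℕ t′ ∸ toℕ t < r
          u<r = ≤-<-trans (m∸n≤m (toℕ t′) (toℕ t)) (toℕ<n t′)
          lemma : ∀ N r m → N * (r * m) ≡ r * (N * m)
          lemma = solve-∀

      lowerExponent : ∃[ i ] n i ∣ M × z ∈ (a i mod n i)
      lowerExponent with any? (λ t → n (class t) ∣? M)
      ... | yes (t , n∣M) = class t , n∣M , ∈mod-cancel z (toℕ t) n∣M (∈class t)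
      ... | no  ∤M        = contradiction (λ t n∣M → ∤M (t , n∣M)) someLift∣

    -- One list `ds` serves for every exponent: each new modulus is r^(c+1) times a divisor of `N`,
    -- so their number does not grow with `c`.
    removePrime : ∀ c → CoversByDivisors (N * r ^ c) → CoversByDivisors N
    removePrime zero    covers = subst CoversByDivisors (*-identityʳ N) covers
    removePrime (suc c) covers = removePrime c (lowerExponent c covers)

  ¬coversByDivisors-1 : (∀ i → 1 < n i) → ¬ CoversByDivisors 1
  ¬coversByDivisors-1 >1 covers with i , n∣1 , _ ← covers (+ 0) = >⇒≢ (>1 i) (∣1⇒≡1 n∣1)

-- Necessity: the excluded exponent patterns.

module _ {N} (C : CoveringNumber N) where
  open CoveringNumber C renaming (divides to modulus∣)

  coversByDivisors : CoversByDivisors residue modulus N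
  coversByDivisors z with i , z∈ ← cover z = i , modulus∣ i , z∈

¬covering-1 : ¬ CoveringNumber 1
¬covering-1 C = ¬coversByDivisors-1 residue modulus >1 (coversByDivisors C)
  where open CoveringNumber C

prime>1 : ∀ {p} → Prime p → 1 < p
prime>1 {p} pp = nonTrivial⇒n>1 p
  where instance _ = prime⇒nonTrivial pp

module _ {k} (a : Vector ℤ k) (n : Vector ℕ k)
         (distinct : Injective _≡_ _≡_ n) (>1 : ∀ i → 1 < n i) where

  ¬coversByDivisors-pᵃ : ∀ {p} → Prime p → ∀ c → ¬ CoversByDivisors a n (p ^ c)
  ¬coversByDivisors-pᵃ {p} pp c =
    ¬coversByDivisors-1 a n >1
    ∘ removePrime a n distinct pp divisorsAmong-1 (prime>1 pp) c
    ∘ subst (CoversByDivisors a n) (sym (*-identityˡ (p ^ c)))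

  -- Two divisors of `p` against q > p ≥ 2; the remaining `p` is treated as a prime power with
  -- exponent 1.
  ¬coversByDivisors-pqᵇ : ∀ {p q} → Prime p → Prime q → p < q → ∀ c → ¬ CoversByDivisors a n (p * q ^ c)
  ¬coversByDivisors-pqᵇ {p} {q} pp pq p<q c =
    ¬coversByDivisors-pᵃ pp 1
    ∘ subst (CoversByDivisors a n) (sym (^-identityʳ p))
    ∘ removePrime a n distinct pq among (≤-<-trans (prime>1 pp) p<q) c
    where
    among : DivisorsAmong p (1 ∷ 1 * p ∷ [])
    among = divisorsAmong-* pp divisorsAmong-1 ∘ subst (_ ∣_) (sym (*-identityˡ p))

  ¬coversByDivisors-pqsᶜ : ∀ {p q s} → Prime p → Prime q → Prime s → p < q → q < s →
                      ∀ c → ¬ CoversByDivisors a n (p * q * s ^ c)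
  ¬coversByDivisors-pqsᶜ {p} {q} {s} pp pq ps p<q q<s c =
    ¬coversByDivisors-pqᵇ pp pq p<q 1
    ∘ subst (CoversByDivisors a n) (cong (p *_) (sym (^-identityʳ q)))
    ∘ removePrime a n distinct ps among 4<s c
    where
    among : DivisorsAmong (p * q) (1 ∷ 1 * p ∷ 1 * q ∷ 1 * p * q ∷ [])
    among = divisorsAmong-* pq
      (divisorsAmong-* pp divisorsAmong-1 ∘ subst (_ ∣_) (sym (*-identityˡ p)))
    4<s : 4 < s
    -- From 2 ≤ p < q < s alone comes 4 ≤ s; equality is excluded because 4 is composite.
    4<s = ≤∧≢⇒< (≤-trans (s≤s (≤-trans (s≤s (prime>1 pp)) p<q)) q<s)
                λ { refl → composite⇒¬prime composite[4] ps }

-- When the conclusion fails, the product is 1, p^a, p q^b or p q s^c: every exponent but that of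
-- the largest prime equals 1.
necessity : ∀ r (α : Vector ℕ r) → (∀ i → 0 < α i) →
  (Σ[ p ∈ Vector ℕ r ] ((∀ i → Prime (p i)) × StrictlyIncreasing p × CoveringNumber (∏ (λ i → p i ^ α i)))) →
  (Σ[ e ∈ r ≡ 2 ] α (cast (sym e) zero) ≥ 2)
  ⊎ (Σ[ e ∈ r ≡ 3 ] (α (cast (sym e) zero) ⊔ α (cast (sym e) (suc zero))) ≥ 2)
  ⊎ r ≥ 4
necessity 0 α 0<α (p , pp , p↗ , C) = contradiction C ¬covering-1
necessity 1 α 0<α (p , pp , p↗ , C) = contradiction
  (subst (CoversByDivisors residue modulus) (*-identityʳ _) (coversByDivisors C))
  (¬coversByDivisors-pᵃ residue modulus distinct >1 (pp zero) (α zero))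
  where open CoveringNumber C
necessity 2 α 0<α (p , pp , p↗ , C) with 2 ≤? α zero
... | yes 2≤α₀ = inj₁ (refl , 2≤α₀)
... | no  2≰α₀ = contradiction
  (subst (CoversByDivisors residue modulus)
    (cong₂ _*_ (trans (cong (p zero ^_) α₀≡1) (^-identityʳ (p zero)))
               (*-identityʳ (p (suc zero) ^ α (suc zero))))
    (coversByDivisors C))
  (¬coversByDivisors-pqᵇ residue modulus distinct >1 (pp zero) (pp (suc zero)) (p↗ (s≤s z≤n)) (α (suc zero)))
  where
  open CoveringNumber C
  α₀≡1 : α zero ≡ 1
  α₀≡1 = ≤-antisym (s≤s⁻¹ (≰⇒> 2≰α₀)) (0<α zero)
necessity 3 α 0<α (p , pp , p↗ , C) with 2 ≤? α zero ⊔ α (suc zero)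
... | yes 2≤α₀⊔α₁ = inj₂ (inj₁ (refl , 2≤α₀⊔α₁))
... | no  2≰α₀⊔α₁ = contradiction
  (subst (CoversByDivisors residue modulus) eq (coversByDivisors C))
  (¬coversByDivisors-pqsᶜ residue modulus distinct >1 (pp zero) (pp (suc zero)) (pp (suc (suc zero)))
    (p↗ (s≤s z≤n)) (p↗ (s≤s (s≤s z≤n))) (α (suc (suc zero))))
  where
  open CoveringNumber C
  ⊔≤1 : α zero ⊔ α (suc zero) ≤ 1
  ⊔≤1 = s≤s⁻¹ (≰⇒> 2≰α₀⊔α₁)
  pᵢ^1 : ∀ i → α i ≤ 1 → p i ^ α i ≡ p i
  pᵢ^1 i αᵢ≤1 = trans (cong (p i ^_) (≤-antisym αᵢ≤1 (0<α i))) (^-identityʳ _)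
  eq : ∏ (λ i → p i ^ α i) ≡ p zero * p (suc zero) * p (suc (suc zero)) ^ α (suc (suc zero))
  eq = trans
    (cong₂ _*_ (pᵢ^1 zero (m⊔n≤o⇒m≤o _ _ ⊔≤1))
      (cong₂ _*_ (pᵢ^1 (suc zero) (m⊔n≤o⇒n≤o _ _ ⊔≤1)) (*-identityʳ _)))
    (sym (*-assoc (p zero) _ _))
necessity (suc (suc (suc (suc r)))) α 0<α _ = inj₂ (inj₂ (s≤s (s≤s (s≤s (s≤s z≤n)))))

-- Explicit covering numbers.

covering-∣ : ∀ {N M} → 0 < M → N ∣ M → CoveringNumber N → CoveringNumber M
covering-∣ 0<M N∣M C = record
  { positive = 0<M ; size = size ; residue = residue ; modulus = modulus ; cover = cover
  ; distinct = distinct ; >1 = >1 ; divides = λ i → ∣-trans (modulus∣ i) N∣M }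
  where open CoveringNumber C renaming (divides to modulus∣)

-- A decidable finite form: since all moduli divide `N`, one period 0, ..., N - 1 represents all
-- integers.
IsDistinctDivisorCover : ∀ {k} → ℕ → Vector ℕ k → Vector ℕ k → Set
IsDistinctDivisorCover N a n =
  (∀ (m : Fin N) → ∃[ i ] (+ n i) Signed.∣ (+ toℕ m ℤ.- + a i)) ×
  (∀ i j → n i ≡ n j → i ≡ j) ×
  (∀ i → 1 < n i) ×
  (∀ i → n i ∣ N)

isDistinctDivisorCover? : ∀ {k} N (a n : Vector ℕ k) → Dec (IsDistinctDivisorCover N a n)
isDistinctDivisorCover? N a n =
  all? (λ m → any? λ i → (+ n i) Signed.∣? (+ toℕ m ℤ.- + a i)) ×-dec
  all? (λ i → all? λ j → (n i ≟ n j) →-dec (i ≟ᶠ j)) ×-dec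
  all? (λ i → 1 <? n i) ×-dec
  all? (λ i → n i ∣? N)

isDistinctDivisorCover⇒covering : ∀ {k N} {a n : Vector ℕ k} → .{{NonZero N}} →
                                  IsDistinctDivisorCover N a n → CoveringNumber N
isDistinctDivisorCover⇒covering {k} {N} {a} {n} (covers , inj , >1 , n∣N) = record
  { positive = >-nonZero⁻¹ N ; size = k ; residue = +_ ∘ a ; modulus = n ; cover = cover
  ; distinct = inj _ _ ; >1 = >1 ; divides = n∣N }
  where
  cover : IsCover (+_ ∘ a) n
  cover z with covers (fromℕ< (n%ℕd<d z N))
  ... | i , Signed.divides x eq with n∣N i
  ... | divides q N≡qn =
    -- With m = z mod N, the witness combines m = x n + a, z = m + y N and N = q n, where y is the
    -- quotient of `z` by `N`.
    i , x ℤ.+ (z /ℕ N) ℤ.* + q , (begin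
      z
        ≡⟨ a≡a%ℕn+[a/ℕn]*n z N ⟩
      + m ℤ.+ (z /ℕ N) ℤ.* + N
        ≡⟨ cong₂ (λ u v → u ℤ.+ (z /ℕ N) ℤ.* v) m≡ (trans (cong +_ N≡qn) (ℤₚ.pos-* q (n i))) ⟩
      (x ℤ.* + n i ℤ.+ + a i) ℤ.+ (z /ℕ N) ℤ.* (+ q ℤ.* + n i)
        ≡⟨ lemma₂ x (+ n i) (+ a i) (z /ℕ N) (+ q) ⟩
      + a i ℤ.+ + n i ℤ.* (x ℤ.+ (z /ℕ N) ℤ.* + q) ∎)
    where
    open ≡-Reasoning
    m = z %ℕ N
    lemma₁ : ∀ m a → m ≡ (m ℤ.- a) ℤ.+ a
    lemma₁ = ℤSolver.solve-∀
    lemma₂ : ∀ x n a y q → (x ℤ.* n ℤ.+ a) ℤ.+ y ℤ.* (q ℤ.* n) ≡ a ℤ.+ n ℤ.* (x ℤ.+ y ℤ.* q)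
    lemma₂ = ℤSolver.solve-∀
    m≡ : + m ≡ x ℤ.* + n i ℤ.+ + a i
    m≡ = begin
      + m                        ≡⟨ lemma₁ (+ m) (+ a i) ⟩
      (+ m ℤ.- + a i) ℤ.+ + a i  ≡⟨ cong (λ u → (+ u ℤ.- + a i) ℤ.+ + a i) (toℕ-fromℕ< (n%ℕd<d z N)) ⟨
      (+ toℕ (fromℕ< (n%ℕd<d z N)) ℤ.- + a i) ℤ.+ + a i
                                 ≡⟨ cong (ℤ._+ + a i) eq ⟩
      x ℤ.* + n i ℤ.+ + a i      ∎

-- The implicit `True` argument makes the type checker verify the cover by evaluating the decision
-- procedure.
coveringBy : ∀ {k} N .{{_ : NonZero N}} (a n : Vec ℕ k) →
             {_ : True (isDistinctDivisorCover? N (lookup a) (lookup n))} → CoveringNumber N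
coveringBy N a n {isCover} =
  isDistinctDivisorCover⇒covering {a = lookup a} {lookup n} (toWitness isCover)

covering-12 : CoveringNumber 12
-- The classes modulo 2, 3 and 4 miss only 2 and 10 modulo 12, which the last two classes take. Here
-- and in the next two covers, every divisor greater than 1 is a modulus.
covering-12 = coveringBy 12
  (1 ∷ 0 ∷ 0 ∷ 2 ∷ 10 ∷ [])
  (2 ∷ 3 ∷ 4 ∷ 6 ∷ 12 ∷ [])

covering-90 : CoveringNumber 90
covering-90 = coveringBy 90
  (0 ∷ 1 ∷ 0 ∷ 3 ∷ 5 ∷ 9  ∷ 11 ∷ 11 ∷ 23 ∷ 17 ∷ 28 ∷ [])
  (2 ∷ 3 ∷ 5 ∷ 6 ∷ 9 ∷ 10 ∷ 15 ∷ 18 ∷ 30 ∷ 45 ∷ 90 ∷ [])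

covering-210 : CoveringNumber 210
covering-210 = coveringBy 210
  (1 ∷ 2 ∷ 3 ∷ 4 ∷ 0 ∷ 6  ∷ 10 ∷ 12 ∷ 18 ∷ 0  ∷ 19 ∷ 6  ∷ 64 ∷ 9   ∷ 158 ∷ [])
  (2 ∷ 3 ∷ 5 ∷ 6 ∷ 7 ∷ 10 ∷ 14 ∷ 15 ∷ 21 ∷ 30 ∷ 35 ∷ 42 ∷ 70 ∷ 105 ∷ 210 ∷ [])

-- Increasing sequences of primes.

m≤n⇒m∣n! : ∀ {m n} → .{{NonZero m}} → m ≤ n → m ∣ n !
m≤n⇒m∣n! {suc m} m≤n = ∣-trans (m∣m*n (m !)) (m≤n⇒m!∣n! m≤n)

-- Euclid's argument: a prime factor of b! + 1 that is at most `b` would also divide b!, hence 1.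
primeAbove : ∀ b → ∃[ p ] Prime p × b < p
primeAbove b with factorise (suc (b !))
... | record { factors = [] ; isFactorisation = eq } =
  contradiction (suc-injective eq) (m<n⇒n≢0 (1≤n! b))
... | record { factors = p ∷ ps ; isFactorisation = eq ; factorsPrime = pp ∷ _ } = p , pp , ≰⇒> p≰b
  where
  instance _ = prime⇒nonZero pp
  p≰b : ¬ p ≤ b
  p≰b p≤b = >⇒≢ (prime>1 pp) (∣1⇒≡1 (∣m+n∣m⇒∣n
    (subst (p ∣_) (trans (sym eq) (+-comm 1 (b !))) (m∣m*n _)) (m≤n⇒m∣n! p≤b)))

-- The strict lower bound `b` allows building from the front: the tail is bounded below by the prime
-- put before it.
record AscendingPrimes (b r : ℕ) : Set where
  constructor ascending
  field
    primes     : Vector ℕ r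
    isPrime    : ∀ i → Prime (primes i)
    increasing : StrictlyIncreasing primes
    above      : ∀ i → b < primes i

open AscendingPrimes

none : ∀ {b} → AscendingPrimes b 0
none = ascending []ᵛ (λ ()) (λ { {()} }) (λ ())

prepend : ∀ {b r} p → Prime p → b < p → AscendingPrimes p r → AscendingPrimes b (suc r)
prepend {b} {r} p pp b<p A = ascending (p ∷ᵛ primes A) prime↗ increasing↗ above↗
  where
  prime↗ : ∀ i → Prime ((p ∷ᵛ primes A) i)
  prime↗ zero    = pp
  prime↗ (suc i) = isPrime A i
  increasing↗ : StrictlyIncreasing (p ∷ᵛ primes A)
  increasing↗ {zero}  {suc j} _   = above A j
  increasing↗ {suc i} {suc j} i<j = increasing A (s<s⁻¹ i<j)
  above↗ : ∀ i → b < (p ∷ᵛ primes A) i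
  above↗ zero    = b<p
  above↗ (suc i) = <-trans b<p (above A i)

prependPrime : ∀ {b r} p → {_ : True (prime? p)} → {_ : True (b <? p)} →
               AscendingPrimes p r → AscendingPrimes b (suc r)
prependPrime p {pp} {b<p} = prepend p (toWitness pp) (toWitness b<p)

ascendingPrimes : ∀ b r → AscendingPrimes b r
ascendingPrimes b zero    = none
ascendingPrimes b (suc r) with p , pp , b<p ← primeAbove b = prepend p pp b<p (ascendingPrimes p r)

-- Sufficiency: the product is a multiple of 12, 90 or 210.

∏-primePowers>0 : ∀ {r} (p α : Vector ℕ r) → (∀ i → Prime (p i)) → 0 < ∏ (λ i → p i ^ α i)
∏-primePowers>0 {zero}  p α pp = s≤s z≤n
∏-primePowers>0 {suc r} p α pp =
  *-mono-≤ (m^n>0 (p zero) (α zero)) (∏-primePowers>0 (p ∘ suc) (α ∘ suc) (pp ∘ suc))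
  where instance _ = prime⇒nonZero (pp zero)

realise : ∀ {b r N} (α : Vector ℕ r) (A : AscendingPrimes b r) →
  N ∣ ∏ (λ i → primes A i ^ α i) → CoveringNumber N →
  Σ[ p ∈ Vector ℕ r ] ((∀ i → Prime (p i)) × StrictlyIncreasing p × CoveringNumber (∏ (λ i → p i ^ α i)))
realise α A N∣∏ C = primes A , isPrime A , increasing A ,
  covering-∣ (∏-primePowers>0 (primes A) α (isPrime A)) N∣∏ C

sufficiency : ∀ r (α : Vector ℕ r) → (∀ i → 0 < α i) →
  (Σ[ e ∈ r ≡ 2 ] α (cast (sym e) zero) ≥ 2)
  ⊎ (Σ[ e ∈ r ≡ 3 ] (α (cast (sym e) zero) ⊔ α (cast (sym e) (suc zero))) ≥ 2)
  ⊎ r ≥ 4 →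
  Σ[ p ∈ Vector ℕ r ] ((∀ i → Prime (p i)) × StrictlyIncreasing p × CoveringNumber (∏ (λ i → p i ^ α i)))
sufficiency _ α 0<α (inj₁ (refl , 2≤α₀)) =
  realise {0} α (prependPrime 2 (prependPrime 3 none))
    (*-pres-∣ (^-monoʳ-∣ 2 2≤α₀) (*-pres-∣ (^-monoʳ-∣ 3 (0<α (suc zero))) (1∣ 1))) covering-12
sufficiency _ α 0<α (inj₂ (inj₁ (refl , 2≤α₀⊔α₁))) with ⊔-sel (α zero) (α (suc zero))
-- The maximum is one of the two exponents: 2² in the product gives the divisor 12, and 3² gives 90.
... | inj₁ ⊔≡α₀ =
  realise {0} α (prependPrime 2 (prependPrime 3 (prependPrime 5 none)))
    (*-pres-∣ (^-monoʳ-∣ 2 (subst (2 ≤_) ⊔≡α₀ 2≤α₀⊔α₁))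
      (*-pres-∣ (^-monoʳ-∣ 3 (0<α (suc zero))) (1∣ _))) covering-12
... | inj₂ ⊔≡α₁ =
  realise {0} α (prependPrime 2 (prependPrime 3 (prependPrime 5 none)))
    (*-pres-∣ (^-monoʳ-∣ 2 (0<α zero))
      (*-pres-∣ (^-monoʳ-∣ 3 (subst (2 ≤_) ⊔≡α₁ 2≤α₀⊔α₁))
        (*-pres-∣ (^-monoʳ-∣ 5 (0<α (suc (suc zero)))) (1∣ 1)))) covering-90
sufficiency (suc (suc (suc (suc r)))) α 0<α (inj₂ (inj₂ _)) =
  -- Beyond 2, 3, 5, 7 any larger increasing primes will do, as 210 already divides the product.
  realise {0} α
    (prependPrime 2 (prependPrime 3 (prependPrime 5 (prependPrime 7 (ascendingPrimes 7 r)))))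
    (*-pres-∣ (^-monoʳ-∣ 2 (0<α zero))
      (*-pres-∣ (^-monoʳ-∣ 3 (0<α (suc zero)))
        (*-pres-∣ (^-monoʳ-∣ 5 (0<α (suc (suc zero))))
          (*-pres-∣ (^-monoʳ-∣ 7 (0<α (suc (suc (suc zero))))) (1∣ _))))) covering-210
sufficiency (suc (suc (suc zero))) α 0<α (inj₂ (inj₂ (s≤s (s≤s (s≤s ())))))
sufficiency (suc (suc zero)) α 0<α (inj₂ (inj₂ (s≤s (s≤s ()))))
sufficiency (suc zero) α 0<α (inj₂ (inj₂ (s≤s ())))

theorem1p2 : (r : ℕ) (α : Vector ℕ r) → (∀ i → 0 < α i) →
    (Σ[ p ∈ Vector ℕ r ] ((∀ i → Prime (p i)) × StrictlyIncreasing p × CoveringNumber (∏ (λ i → p i ^ α i))))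
    ⇔
    ((Σ[ e ∈ r ≡ 2 ] α (cast (sym e) zero) ≥ 2)
    ⊎ (Σ[ e ∈ r ≡ 3 ] (α (cast (sym e) zero) ⊔ α (cast (sym e) (suc zero))) ≥ 2)
    ⊎ r ≥ 4)
theorem1p2 r α 0<α = mk⇔ (necessity r α 0<α) (sufficiency r α 0<α)
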